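{- Let $V$ be a finite-dimensional representation of a group $G$ over a field $k$. The Lie algebra of Lie elements $\mathcal{L}(V)\subset k[G]$ is a representation of $G$ where elements of the group act by conjugation: for every $g\in G$ and $x\in\mathcal{L}(V)$ one has $gxg^{ -1}\in\mathcal{L}(V)$, and $x\mapsto gxg^{ -1}$ defines a linear action of $G$ on $\mathcal{L}(V)$.
   Context: For $g\in G$ and $m\ge 1$ define linear operators $\mathcal{G}_m\langle g\rangle,\mathcal{A}_m\langle g\rangle$ on the exterior power $V^{\wedge m}$ by $$\mathcal{G}_m\langle g\rangle(v_1\wedge\dots\wedge v_m)=g(v_1)\wedge\dots\wedge g(v_m),$$ $$\mathcal{A}_m\langle g\rangle(v_1\wedge\dots\wedge v_m)=\sum_{p=1}^m v_1\wedge\dots\wedge g(v_p)\wedge\dots\wedge v_m,$$ and for $m=0$ (with $V^{\wedge 0}=k$) put $\mathcal{G}_0\langle g\rangle=\mathrm{Id}$, $\mathcal{A}_0\langle g\rangle=0$. Extend $\mathcal{G}_m,\mathcal{A}_m$ by linearity to maps $k[G]\to\mathrm{End}(V^{\wedge m})$ on the group algebra. An element $x\in k[G]$ is a Lie element (with respect to $V$) if $\mathcal{G}_m\langle x\rangle=\mathcal{A}_m\langle x\rangle$ for all $m=0,1,\dots,\dim V$. The set of Lie elements is $\mathcal{L}(V)\subset k[G]$; it is a Lie subalgebra of $k[G]$ with respect to the commutator bracket $[p,q]=pq-qp$. -}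

module Defs where

open import Algebra.Apartness.Bundles using (HeytingField; HeytingCommutativeRing)
open import Algebra.Bundles using (CommutativeMonoid; CommutativeRing; Group)
open import Algebra.Module.Bundles using (LeftModule)
open import Algebra.Module.Morphism.Structures using (module LeftModuleMorphisms)
import Algebra.Properties.AbelianGroup as AbelianGroupProperties
import Algebra.Properties.CommutativeSemigroup as CommutativeSemigroupProperties
import Algebra.Properties.CommutativeMonoid.Sum as Sum
open import Data.Fin.Base using (Fin; zero; suc)
open import Data.Fin.Properties using (_≟_)
import Data.Fin.Properties as Fin
open import Data.Nat.Base using (ℕ; zero; suc; _≤_)
open import Data.Product.Base using (Σ; Σ-syntax; _×_; _,_; proj₁; proj₂)
open import Data.Vec.Functional using (Vector; updateAt; removeAt; map)
open import Data.Vec.Functional.Properties using (updateAt-updates; updateAt-minimal)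
open import Function.Base using (_∘_; const)
open import Level using (Level; _⊔_) renaming (suc to lsuc)
open import Relation.Binary.Core using (Rel)
open import Relation.Binary.PropositionalEquality as ≡ using (_≡_; _≢_)
import Relation.Binary.Reasoning.Setoid as SetoidReasoning
open import Relation.Nullary using (yes; no; contradiction)
open import Relation.Unary using (Pred)

private
  variable
    r ℓr a ℓa m ℓm n ℓn p ℓp x ℓ : Level
    A : Set a

infixl 20 _[_]≔_
_[_]≔_ : ∀ {d} → Vector A d → Fin d → A → Vector A d
v [ i ]≔ y = updateAt v i (const y)

-- Classically every field is a Heyting field, with x # y meaning ¬ x ≈ y.
scalars : ∀ {c ℓ₁ ℓ₂} → HeytingField c ℓ₁ ℓ₂ → CommutativeRing c ℓ₁
scalars F = HeytingCommutativeRing.commutativeRing (HeytingField.heytingCommutativeRing F)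

-- Everything up to the Lie elements makes sense over a commutative ring k.

module _ (k : CommutativeRing r ℓr) where

  open CommutativeRing k using (ring; _≈_; 0#; 1#)
    renaming (Carrier to K; _+_ to _+ᵏ_; _*_ to _*ᵏ_)
  private module k = CommutativeRing k

  VectorSpace : ∀ m ℓm → Set (r ⊔ ℓr ⊔ lsuc (m ⊔ ℓm))
  VectorSpace = LeftModule ring

  module _ (M : VectorSpace m ℓm) where
    open LeftModule M
    open Sum +ᴹ-commutativeMonoid using (sum-syntax)

    record FiniteDimensional : Set (r ⊔ ℓr ⊔ m ⊔ ℓm) where
      field
        dim         : ℕ
        basis       : Vector Carrierᴹ dim
        spanning    : ∀ v → Σ[ c ∈ Vector K dim ] v ≈ᴹ ∑[ i < dim ] (c i *ₗ basis i)
        independent : ∀ (c : Vector K dim) → ∑[ i < dim ] (c i *ₗ basis i) ≈ᴹ 0ᴹ →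
                      ∀ i → c i ≈ 0#

    record IsSubspace (P : Pred Carrierᴹ p) : Set (r ⊔ m ⊔ ℓm ⊔ p) where
      field
        resp : ∀ {u v} → u ≈ᴹ v → P u → P v
        0∈   : P 0ᴹ
        +∈   : ∀ {u v} → P u → P v → P (u +ᴹ v)
        -∈   : ∀ {u} → P u → P (-ᴹ u)
        *∈   : ∀ c {u} → P u → P (c *ₗ u)

    subspace : {P : Pred Carrierᴹ p} → IsSubspace P → VectorSpace (m ⊔ p) ℓm
    subspace {P = P} isSubspace = record
      { Carrierᴹ = Σ Carrierᴹ P
      ; _≈ᴹ_ = λ u v → proj₁ u ≈ᴹ proj₁ v
      ; _+ᴹ_ = λ (u , Pu) (v , Pv) → u +ᴹ v , +∈ Pu Pv
      ; _*ₗ_ = λ c (u , Pu) → c *ₗ u , *∈ c Pu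
      ; 0ᴹ = 0ᴹ , 0∈
      ; -ᴹ_ = λ (u , Pu) → -ᴹ u , -∈ Pu
      ; isLeftModule = record
        { isLeftSemimodule = record
          { +ᴹ-isCommutativeMonoid = record
            { isMonoid = record
              { isSemigroup = record
                { isMagma = record
                  { isEquivalence = record { refl = ≈ᴹ-refl ; sym = ≈ᴹ-sym ; trans = ≈ᴹ-trans }
                  ; ∙-cong = +ᴹ-cong
                  }
                ; assoc = λ _ _ _ → +ᴹ-assoc _ _ _
                }
              ; identity = (λ _ → +ᴹ-identityˡ _) , (λ _ → +ᴹ-identityʳ _)
              }
            ; comm = λ _ _ → +ᴹ-comm _ _
            }
          ; isPreleftSemimodule = record
            { *ₗ-cong = *ₗ-cong
            ; *ₗ-zeroˡ = λ _ → *ₗ-zeroˡ _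
            ; *ₗ-distribʳ = λ _ _ _ → *ₗ-distribʳ _ _ _
            ; *ₗ-identityˡ = λ _ → *ₗ-identityˡ _
            ; *ₗ-assoc = λ _ _ _ → *ₗ-assoc _ _ _
            ; *ₗ-zeroʳ = λ _ → *ₗ-zeroʳ _
            ; *ₗ-distribˡ = λ _ _ _ → *ₗ-distribˡ _ _ _
            }
          }
        ; -ᴹ‿cong = -ᴹ‿cong
        ; -ᴹ‿inverse = (λ _ → -ᴹ‿inverseˡ _) , (λ _ → -ᴹ‿inverseʳ _)
        }
      }
      where open IsSubspace isSubspace

  module _ (M : VectorSpace m ℓm) (N : VectorSpace n ℓn) where
    private
      module M = LeftModule M
      module N = LeftModule N
    open LeftModuleMorphisms M.rawLeftModule N.rawLeftModule

    IsLinear : (M.Carrierᴹ → N.Carrierᴹ) → Set (r ⊔ m ⊔ ℓm ⊔ ℓn)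
    IsLinear = IsLeftModuleHomomorphism

    isLinear⁺ : {f : M.Carrierᴹ → N.Carrierᴹ} →
                (∀ {u v} → u M.≈ᴹ v → f u N.≈ᴹ f v) →
                (∀ u v → f (u M.+ᴹ v) N.≈ᴹ f u N.+ᴹ f v) →
                (∀ c v → f (c M.*ₗ v) N.≈ᴹ c N.*ₗ f v) →
                IsLinear f
    isLinear⁺ {f} f-cong f-+ f-* = record
      { +ᴹ-isGroupHomomorphism = record
        { isMonoidHomomorphism = record
          { isMagmaHomomorphism = record
            { isRelHomomorphism = record { cong = f-cong }
            ; homo = f-+
            }
          ; ε-homo = f-0
          }
        ; ⁻¹-homo = λ v → inverseˡ-unique _ _
            (N.≈ᴹ-trans (N.≈ᴹ-sym (f-+ _ _)) (N.≈ᴹ-trans (f-cong (M.-ᴹ‿inverseˡ v)) f-0))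
        }
      ; *ₗ-homo = f-*
      }
      where
      open AbelianGroupProperties N.+ᴹ-abelianGroup using (inverseˡ-unique)
      f-0 : f M.0ᴹ N.≈ᴹ N.0ᴹ
      f-0 = N.≈ᴹ-trans (f-cong (M.≈ᴹ-sym (M.*ₗ-zeroˡ M.0ᴹ)))
              (N.≈ᴹ-trans (f-* 0# M.0ᴹ) (N.*ₗ-zeroˡ _))

    record LinearMap : Set (r ⊔ m ⊔ ℓm ⊔ n ⊔ ℓn) where
      field
        ⟦_⟧      : M.Carrierᴹ → N.Carrierᴹ
        isLinear : IsLinear ⟦_⟧
      open LeftModuleMorphisms.IsLeftModuleHomomorphism isLinear public
        using (⟦⟧-cong; +ᴹ-homo; *ₗ-homo; 0ᴹ-homo; -ᴹ-homo)

    open LinearMap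

    Hom : VectorSpace (r ⊔ m ⊔ ℓm ⊔ n ⊔ ℓn) (m ⊔ ℓn)
    Hom = record
      { Carrierᴹ = LinearMap
      ; _≈ᴹ_ = λ f g → ∀ v → ⟦ f ⟧ v N.≈ᴹ ⟦ g ⟧ v
      ; _+ᴹ_ = λ f g → record
        { ⟦_⟧ = λ v → ⟦ f ⟧ v N.+ᴹ ⟦ g ⟧ v
        ; isLinear = isLinear⁺
            (λ e → N.+ᴹ-cong (⟦⟧-cong f e) (⟦⟧-cong g e))
            (λ u v → N.≈ᴹ-trans (N.+ᴹ-cong (+ᴹ-homo f u v) (+ᴹ-homo g u v))
               (interchange _ _ _ _))
            (λ c v → N.≈ᴹ-trans (N.+ᴹ-cong (*ₗ-homo f c v) (*ₗ-homo g c v))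
               (N.≈ᴹ-sym (N.*ₗ-distribˡ _ _ _)))
        }
      ; _*ₗ_ = λ c f → record
        { ⟦_⟧ = λ v → c N.*ₗ ⟦ f ⟧ v
        ; isLinear = isLinear⁺
            (λ e → N.*ₗ-cong k.refl (⟦⟧-cong f e))
            (λ u v → N.≈ᴹ-trans (N.*ₗ-cong k.refl (+ᴹ-homo f u v)) (N.*ₗ-distribˡ _ _ _))
            (λ b v → N.≈ᴹ-trans (N.*ₗ-cong k.refl (*ₗ-homo f b v))
               (N.≈ᴹ-trans (N.≈ᴹ-sym (N.*ₗ-assoc _ _ _))
               (N.≈ᴹ-trans (N.*ₗ-cong (k.*-comm _ _) N.≈ᴹ-refl) (N.*ₗ-assoc _ _ _))))
        }
      ; 0ᴹ = record
        { ⟦_⟧ = λ _ → N.0ᴹ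
        ; isLinear = isLinear⁺
            (λ _ → N.≈ᴹ-refl)
            (λ _ _ → N.≈ᴹ-sym (N.+ᴹ-identityˡ _))
            (λ _ _ → N.≈ᴹ-sym (N.*ₗ-zeroʳ _))
        }
      ; -ᴹ_ = λ f → record
        { ⟦_⟧ = λ v → N.-ᴹ ⟦ f ⟧ v
        ; isLinear = isLinear⁺
            (λ e → N.-ᴹ‿cong (⟦⟧-cong f e))
            (λ u v → N.≈ᴹ-trans (N.-ᴹ‿cong (+ᴹ-homo f u v)) (N.≈ᴹ-sym (⁻¹-∙-comm _ _)))
            (λ c v → N.≈ᴹ-sym (inverseˡ-unique _ _ (N.≈ᴹ-trans
               (N.+ᴹ-cong N.≈ᴹ-refl (*ₗ-homo f c v))
               (N.≈ᴹ-trans (N.≈ᴹ-sym (N.*ₗ-distribˡ _ _ _))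
               (N.≈ᴹ-trans (N.*ₗ-cong k.refl (N.-ᴹ‿inverseˡ _)) (N.*ₗ-zeroʳ _))))))
        }
      ; isLeftModule = record
        { isLeftSemimodule = record
          { +ᴹ-isCommutativeMonoid = record
            { isMonoid = record
              { isSemigroup = record
                { isMagma = record
                  { isEquivalence = record
                    { refl = λ _ → N.≈ᴹ-refl
                    ; sym = λ e v → N.≈ᴹ-sym (e v)
                    ; trans = λ d e v → N.≈ᴹ-trans (d v) (e v)
                    }
                  ; ∙-cong = λ d e v → N.+ᴹ-cong (d v) (e v)
                  }
                ; assoc = λ _ _ _ _ → N.+ᴹ-assoc _ _ _
                }
              ; identity = (λ _ _ → N.+ᴹ-identityˡ _) , (λ _ _ → N.+ᴹ-identityʳ _)
              }
            ; comm = λ _ _ _ → N.+ᴹ-comm _ _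
            }
          ; isPreleftSemimodule = record
            { *ₗ-cong = λ d e v → N.*ₗ-cong d (e v)
            ; *ₗ-zeroˡ = λ _ _ → N.*ₗ-zeroˡ _
            ; *ₗ-distribʳ = λ _ _ _ _ → N.*ₗ-distribʳ _ _ _
            ; *ₗ-identityˡ = λ _ _ → N.*ₗ-identityˡ _
            ; *ₗ-assoc = λ _ _ _ _ → N.*ₗ-assoc _ _ _
            ; *ₗ-zeroʳ = λ _ _ → N.*ₗ-zeroʳ _
            ; *ₗ-distribˡ = λ _ _ _ _ → N.*ₗ-distribˡ _ _ _
            }
          }
        ; -ᴹ‿cong = λ e v → N.-ᴹ‿cong (e v)
        ; -ᴹ‿inverse = (λ _ _ → N.-ᴹ‿inverseˡ _) , (λ _ _ → N.-ᴹ‿inverseʳ _)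
        }
      }
      where
      open CommutativeSemigroupProperties
        (CommutativeMonoid.commutativeSemigroup N.+ᴹ-commutativeMonoid) using (interchange)
      open AbelianGroupProperties N.+ᴹ-abelianGroup using (⁻¹-∙-comm; inverseˡ-unique)

  open LinearMap

  End : VectorSpace m ℓm → VectorSpace (r ⊔ m ⊔ ℓm) (m ⊔ ℓm)
  End M = Hom M M

  -- The module presented by generators X and relations _~_ : formal linear
  -- combinations modulo the congruence generated by _~_ and the module axioms.

  infixl 6 _⊕_
  infixr 7 _⊛_
  infixr 8 ⊖_

  data Combination (X : Set x) : Set (r ⊔ x) where
    ⟨_⟩ : X → Combination X
    𝟘   : Combination X
    _⊕_ : Combination X → Combination X → Combination X
    ⊖_  : Combination X → Combination X
    _⊛_ : K → Combination X → Combination X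

  module _ {X : Set x} (_~_ : Rel (Combination X) ℓ) where

    infix 4 _≋_

    data _≋_ : Rel (Combination X) (r ⊔ ℓr ⊔ x ⊔ ℓ) where
      relation    : ∀ {s t} → s ~ t → s ≋ t
      refl        : ∀ {s} → s ≋ s
      sym         : ∀ {s t} → s ≋ t → t ≋ s
      trans       : ∀ {s t u} → s ≋ t → t ≋ u → s ≋ u
      ⊕-cong      : ∀ {s s′ t t′} → s ≋ s′ → t ≋ t′ → s ⊕ t ≋ s′ ⊕ t′
      ⊖-cong      : ∀ {s s′} → s ≋ s′ → ⊖ s ≋ ⊖ s′
      ⊛-cong      : ∀ {b c s s′} → b ≈ c → s ≋ s′ → b ⊛ s ≋ c ⊛ s′
      ⊕-assoc     : ∀ s t u → (s ⊕ t) ⊕ u ≋ s ⊕ (t ⊕ u)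
      ⊕-comm      : ∀ s t → s ⊕ t ≋ t ⊕ s
      ⊕-identityˡ : ∀ s → 𝟘 ⊕ s ≋ s
      ⊖-inverseˡ  : ∀ s → ⊖ s ⊕ s ≋ 𝟘
      ⊛-distribˡ  : ∀ c s t → c ⊛ (s ⊕ t) ≋ c ⊛ s ⊕ c ⊛ t
      ⊛-distribʳ  : ∀ s b c → (b +ᵏ c) ⊛ s ≋ b ⊛ s ⊕ c ⊛ s
      ⊛-assoc     : ∀ b c s → (b *ᵏ c) ⊛ s ≋ b ⊛ (c ⊛ s)
      ⊛-identityˡ : ∀ s → 1# ⊛ s ≋ s
      ⊛-zeroˡ     : ∀ s → 0# ⊛ s ≋ 𝟘
      ⊛-zeroʳ     : ∀ c → c ⊛ 𝟘 ≋ 𝟘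

    Presented : VectorSpace (r ⊔ x) (r ⊔ ℓr ⊔ x ⊔ ℓ)
    Presented = record
      { Carrierᴹ = Combination X
      ; _≈ᴹ_ = _≋_
      ; _+ᴹ_ = _⊕_
      ; _*ₗ_ = _⊛_
      ; 0ᴹ = 𝟘
      ; -ᴹ_ = ⊖_
      ; isLeftModule = record
        { isLeftSemimodule = record
          { +ᴹ-isCommutativeMonoid = record
            { isMonoid = record
              { isSemigroup = record
                { isMagma = record
                  { isEquivalence = record { refl = refl ; sym = sym ; trans = trans }
                  ; ∙-cong = ⊕-cong
                  }
                ; assoc = ⊕-assoc
                }
              ; identity = ⊕-identityˡ , (λ s → trans (⊕-comm s 𝟘) (⊕-identityˡ s))
              }
            ; comm = ⊕-comm
            }
          ; isPreleftSemimodule = record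
            { *ₗ-cong = ⊛-cong
            ; *ₗ-zeroˡ = ⊛-zeroˡ
            ; *ₗ-distribʳ = ⊛-distribʳ
            ; *ₗ-identityˡ = ⊛-identityˡ
            ; *ₗ-assoc = ⊛-assoc
            ; *ₗ-zeroʳ = ⊛-zeroʳ
            ; *ₗ-distribˡ = ⊛-distribˡ
            }
          }
        ; -ᴹ‿cong = ⊖-cong
        ; -ᴹ‿inverse = ⊖-inverseˡ , (λ s → trans (⊕-comm s (⊖ s)) (⊖-inverseˡ s))
        }
      }

  module _ {X : Set x} (N : VectorSpace n ℓn) where
    private module N = LeftModule N

    evaluate : (X → N.Carrierᴹ) → Combination X → N.Carrierᴹ
    evaluate f ⟨ y ⟩   = f y
    evaluate f 𝟘       = N.0ᴹ
    evaluate f (s ⊕ t) = evaluate f s N.+ᴹ evaluate f t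
    evaluate f (⊖ s)   = N.-ᴹ evaluate f s
    evaluate f (c ⊛ s) = c N.*ₗ evaluate f s

    module _ {_~_ : Rel (Combination X) ℓ} (f : X → N.Carrierᴹ)
             (f-resp : ∀ {s t} → s ~ t → evaluate f s N.≈ᴹ evaluate f t) where

      evaluate-cong : ∀ {s t} → _≋_ _~_ s t → evaluate f s N.≈ᴹ evaluate f t
      evaluate-cong (relation e)        = f-resp e
      evaluate-cong refl                = N.≈ᴹ-refl
      evaluate-cong (sym e)             = N.≈ᴹ-sym (evaluate-cong e)
      evaluate-cong (trans d e)         = N.≈ᴹ-trans (evaluate-cong d) (evaluate-cong e)
      evaluate-cong (⊕-cong d e)        = N.+ᴹ-cong (evaluate-cong d) (evaluate-cong e)
      evaluate-cong (⊖-cong e)          = N.-ᴹ‿cong (evaluate-cong e)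
      evaluate-cong (⊛-cong d e)        = N.*ₗ-cong d (evaluate-cong e)
      evaluate-cong (⊕-assoc _ _ _)     = N.+ᴹ-assoc _ _ _
      evaluate-cong (⊕-comm _ _)        = N.+ᴹ-comm _ _
      evaluate-cong (⊕-identityˡ _)     = N.+ᴹ-identityˡ _
      evaluate-cong (⊖-inverseˡ _)      = N.-ᴹ‿inverseˡ _
      evaluate-cong (⊛-distribˡ _ _ _)  = N.*ₗ-distribˡ _ _ _
      evaluate-cong (⊛-distribʳ _ _ _)  = N.*ₗ-distribʳ _ _ _
      evaluate-cong (⊛-assoc _ _ _)     = N.*ₗ-assoc _ _ _
      evaluate-cong (⊛-identityˡ _)     = N.*ₗ-identityˡ _
      evaluate-cong (⊛-zeroˡ _)         = N.*ₗ-zeroˡ _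
      evaluate-cong (⊛-zeroʳ _)         = N.*ₗ-zeroʳ _

      extend : LinearMap (Presented _~_) N
      extend = record
        { ⟦_⟧      = evaluate f
        ; isLinear = isLinear⁺ (Presented _~_) N evaluate-cong (λ _ _ → N.≈ᴹ-refl) (λ _ _ → N.≈ᴹ-refl)
        }

    module _ {_~_ : Rel (Combination X) ℓ} (f g : LinearMap (Presented _~_) N) where

      extensionality : (∀ y → ⟦ f ⟧ ⟨ y ⟩ N.≈ᴹ ⟦ g ⟧ ⟨ y ⟩) → ∀ s → ⟦ f ⟧ s N.≈ᴹ ⟦ g ⟧ s
      extensionality e ⟨ y ⟩   = e y
      extensionality e 𝟘       = N.≈ᴹ-trans (0ᴹ-homo f) (N.≈ᴹ-sym (0ᴹ-homo g))
      extensionality e (s ⊕ t) = N.≈ᴹ-trans (+ᴹ-homo f s t) (N.≈ᴹ-trans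
        (N.+ᴹ-cong (extensionality e s) (extensionality e t)) (N.≈ᴹ-sym (+ᴹ-homo g s t)))
      extensionality e (⊖ s)   = N.≈ᴹ-trans (-ᴹ-homo f s) (N.≈ᴹ-trans
        (N.-ᴹ‿cong (extensionality e s)) (N.≈ᴹ-sym (-ᴹ-homo g s)))
      extensionality e (c ⊛ s) = N.≈ᴹ-trans (*ₗ-homo f c s) (N.≈ᴹ-trans
        (N.*ₗ-cong k.refl (extensionality e s)) (N.≈ᴹ-sym (*ₗ-homo g c s)))

  module _ {M : VectorSpace m ℓm} {N : VectorSpace n ℓn} {P : VectorSpace p ℓp} where
    private module P = LeftModule P

    infixr 9 _∘ₗ_
    _∘ₗ_ : LinearMap N P → LinearMap M N → LinearMap M P
    f ∘ₗ g = record
      { ⟦_⟧      = ⟦ f ⟧ ∘ ⟦ g ⟧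
      ; isLinear = isLinear⁺ M P
          (⟦⟧-cong f ∘ ⟦⟧-cong g)
          (λ u v → P.≈ᴹ-trans (⟦⟧-cong f (+ᴹ-homo g u v)) (+ᴹ-homo f _ _))
          (λ c v → P.≈ᴹ-trans (⟦⟧-cong f (*ₗ-homo g c v)) (*ₗ-homo f c _))
      }

  module _ {M : VectorSpace m ℓm} {N : VectorSpace n ℓn} where
    private
      module M = LeftModule M
      module N = LeftModule N
    open Sum M.+ᴹ-commutativeMonoid using () renaming (sum to sumᴹ)
    open Sum N.+ᴹ-commutativeMonoid using () renaming (sum to sumᴺ)

    applyₗ : M.Carrierᴹ → LinearMap (Hom M N) N
    applyₗ v = record
      { ⟦_⟧      = λ f → ⟦ f ⟧ v
      ; isLinear = isLinear⁺ (Hom M N) N (λ e → e v) (λ _ _ → N.≈ᴹ-refl) (λ _ _ → N.≈ᴹ-refl)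
      }

    sum-homo : (f : LinearMap M N) → ∀ {d} (v : Vector M.Carrierᴹ d) →
               ⟦ f ⟧ (sumᴹ v) N.≈ᴹ sumᴺ (⟦ f ⟧ ∘ v)
    sum-homo f {zero}  v = 0ᴹ-homo f
    sum-homo f {suc d} v = N.≈ᴹ-trans (+ᴹ-homo f _ _)
      (N.+ᴹ-cong N.≈ᴹ-refl (sum-homo f (v ∘ suc)))

  module _ (M : VectorSpace m ℓm) where
    open LeftModule M
    open Sum +ᴹ-commutativeMonoid
    open SetoidReasoning ≈ᴹ-setoid
    open CommutativeSemigroupProperties
      (CommutativeMonoid.commutativeSemigroup +ᴹ-commutativeMonoid) using (x∙yz≈y∙xz)

    sum-zero : ∀ {d} (f : Vector Carrierᴹ d) → (∀ i → f i ≈ᴹ 0ᴹ) → sum f ≈ᴹ 0ᴹ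
    sum-zero {d} f f≈0 = ≈ᴹ-trans (sum-cong-≋ f≈0) (sum-replicate-zero d)

    sum-single : ∀ {d} (f : Vector Carrierᴹ d) i →
                 (∀ j → j ≢ i → f j ≈ᴹ 0ᴹ) → sum f ≈ᴹ f i
    sum-single f zero    f≈0 =
      ≈ᴹ-trans (+ᴹ-cong ≈ᴹ-refl (sum-zero (f ∘ suc) (λ j → f≈0 (suc j) (λ ())))) (+ᴹ-identityʳ _)
    sum-single f (suc i) f≈0 = ≈ᴹ-trans
      (+ᴹ-cong (f≈0 zero (λ ())) (sum-single (f ∘ suc) i (λ j j≢i → f≈0 (suc j) (j≢i ∘ Fin.suc-injective))))
      (+ᴹ-identityˡ _)

    sum-pair : ∀ {d} (f : Vector Carrierᴹ d) i j → i ≢ j →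
               (∀ l → l ≢ i → l ≢ j → f l ≈ᴹ 0ᴹ) → sum f ≈ᴹ f i +ᴹ f j
    sum-pair f zero    zero    i≢j f≈0 = contradiction ≡.refl i≢j
    sum-pair f zero    (suc j) i≢j f≈0 = +ᴹ-cong ≈ᴹ-refl
      (sum-single (f ∘ suc) j (λ l l≢j → f≈0 (suc l) (λ ()) (l≢j ∘ Fin.suc-injective)))
    sum-pair f (suc i) zero    i≢j f≈0 = ≈ᴹ-trans (+ᴹ-cong ≈ᴹ-refl
      (sum-single (f ∘ suc) i (λ l l≢i → f≈0 (suc l) (l≢i ∘ Fin.suc-injective) (λ ()))))
      (+ᴹ-comm _ _)
    sum-pair f (suc i) (suc j) i≢j f≈0 = ≈ᴹ-trans
      (+ᴹ-cong (f≈0 zero (λ ()) (λ ())) (sum-pair (f ∘ suc) i j (i≢j ∘ ≡.cong suc)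
        (λ l l≢i l≢j → f≈0 (suc l) (l≢i ∘ Fin.suc-injective) (l≢j ∘ Fin.suc-injective))))
      (+ᴹ-identityˡ _)

    sum-exchange : ∀ {d} (f g : Vector Carrierᴹ d) i → (∀ j → j ≢ i → f j ≈ᴹ g j) →
                   f i +ᴹ sum g ≈ᴹ g i +ᴹ sum f
    sum-exchange {suc d} f g i f≈g = begin
      f i +ᴹ sum g                        ≈⟨ +ᴹ-cong ≈ᴹ-refl (sum-remove {i = i} g) ⟩
      f i +ᴹ (g i +ᴹ sum (removeAt g i))  ≈⟨ x∙yz≈y∙xz _ _ _ ⟩
      g i +ᴹ (f i +ᴹ sum (removeAt g i))  ≈⟨ +ᴹ-cong ≈ᴹ-refl (+ᴹ-cong ≈ᴹ-refl
                                              (sum-cong-≋ (λ j → f≈g _ (Fin.punchInᵢ≢i i j)))) ⟨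
      g i +ᴹ (f i +ᴹ sum (removeAt f i))  ≈⟨ +ᴹ-cong ≈ᴹ-refl (sum-remove {i = i} f) ⟨
      g i +ᴹ sum f                        ∎

    sum-diagonal : ∀ {d} (f g : Fin d → Fin d → Carrierᴹ) →
                   (∀ i j → j ≢ i → f i j ≈ᴹ g j i) →
                   ∑[ i < d ] f i i +ᴹ ∑[ i < d ] ∑[ j < d ] g i j ≈ᴹ
                   ∑[ i < d ] g i i +ᴹ ∑[ i < d ] ∑[ j < d ] f i j
    sum-diagonal {d} f g f≈g = begin
      ∑[ i < d ] f i i +ᴹ ∑[ i < d ] ∑[ j < d ] g i j   ≈⟨ +ᴹ-cong ≈ᴹ-refl (∑-comm g) ⟩
      ∑[ i < d ] f i i +ᴹ ∑[ i < d ] ∑[ j < d ] g j i   ≈⟨ ∑-distrib-+ (λ i → f i i) (λ i → ∑[ j < d ] g j i) ⟨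
      ∑[ i < d ] (f i i +ᴹ ∑[ j < d ] g j i)            ≈⟨ sum-cong-≋
                                                            (λ i → sum-exchange (f i) (λ j → g j i) i (f≈g i)) ⟩
      ∑[ i < d ] (g i i +ᴹ ∑[ j < d ] f i j)            ≈⟨ ∑-distrib-+ (λ i → g i i) (λ i → ∑[ j < d ] f i j) ⟩
      ∑[ i < d ] g i i +ᴹ ∑[ i < d ] ∑[ j < d ] f i j   ∎

  module _ (V : VectorSpace m ℓm) (d : ℕ) where
    open LeftModule V

    -- For d = 0 only pointwise applies, so the empty wedge freely generates k.
    data ExteriorRelation : Rel (Combination (Vector Carrierᴹ d)) (r ⊔ m ⊔ ℓm) where
      pointwise   : ∀ {v w} → (∀ i → v i ≈ᴹ w i) → ExteriorRelation ⟨ v ⟩ ⟨ w ⟩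
      additive    : ∀ v i x y →
                    ExteriorRelation ⟨ v [ i ]≔ (x +ᴹ y) ⟩ (⟨ v [ i ]≔ x ⟩ ⊕ ⟨ v [ i ]≔ y ⟩)
      homogeneous : ∀ v i c x → ExteriorRelation ⟨ v [ i ]≔ (c *ₗ x) ⟩ (c ⊛ ⟨ v [ i ]≔ x ⟩)
      alternating : ∀ {v i j} → i ≢ j → v i ≈ᴹ v j → ExteriorRelation ⟨ v ⟩ 𝟘

    ExteriorPower : VectorSpace (r ⊔ m) (r ⊔ ℓr ⊔ m ⊔ ℓm)
    ExteriorPower = Presented ExteriorRelation

  module _ {V : VectorSpace m ℓm} {d : ℕ} where
    private
      module V = LeftModule V
      module Λ = LeftModule (ExteriorPower V d)
    open V using (_≈ᴹ_; _+ᴹ_) renaming (Carrierᴹ to U)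
    open Sum Λ.+ᴹ-commutativeMonoid using (sum; sum-syntax; sum-cong-≋; ∑-distrib-+)
    open SetoidReasoning Λ.≈ᴹ-setoid

    ⋀ : Vector U d → Combination (Vector U d)
    ⋀ = ⟨_⟩

    []≔-updates : ∀ (v : Vector U d) i {x} → (v [ i ]≔ x) i ≈ᴹ x
    []≔-updates v i = V.≈ᴹ-reflexive (updateAt-updates i v)

    []≔-minimal : ∀ (v : Vector U d) i {x j} → j ≢ i → (v [ i ]≔ x) j ≈ᴹ v j
    []≔-minimal v i {j = j} j≢i = V.≈ᴹ-reflexive (updateAt-minimal j i v j≢i)

    ⋀-update : ∀ {v w : Vector U d} i {x} → v i ≈ᴹ x → (∀ j → j ≢ i → v j ≈ᴹ w j) →
               ⋀ v Λ.≈ᴹ ⋀ (w [ i ]≔ x)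
    ⋀-update {v} {w} i {x} vi≈x v≈w = relation (pointwise agree)
      where
      agree : ∀ j → v j ≈ᴹ (w [ i ]≔ x) j
      agree j with j ≟ i
      ... | yes ≡.refl = V.≈ᴹ-trans vi≈x (V.≈ᴹ-sym ([]≔-updates w i))
      ... | no  j≢i    = V.≈ᴹ-trans (v≈w j j≢i) (V.≈ᴹ-sym ([]≔-minimal w i j≢i))

    ⋀-additive : ∀ {u v w : Vector U d} i → u i ≈ᴹ v i +ᴹ w i →
                 (∀ j → j ≢ i → v j ≈ᴹ u j) → (∀ j → j ≢ i → w j ≈ᴹ u j) →
                 ⋀ u Λ.≈ᴹ ⋀ v ⊕ ⋀ w
    ⋀-additive {u} i e v≈u w≈u =
      trans (⋀-update i e (λ _ _ → V.≈ᴹ-refl))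
      (trans (relation (additive u i _ _))
      (sym (⊕-cong (⋀-update i V.≈ᴹ-refl v≈u) (⋀-update i V.≈ᴹ-refl w≈u))))

    ⋀-homogeneous : ∀ {u v : Vector U d} i {c} → u i ≈ᴹ c V.*ₗ v i →
                    (∀ j → j ≢ i → v j ≈ᴹ u j) → ⋀ u Λ.≈ᴹ c ⊛ ⋀ v
    ⋀-homogeneous {u} i e v≈u =
      trans (⋀-update i e (λ _ _ → V.≈ᴹ-refl))
      (trans (relation (homogeneous u i _ _))
      (sym (⊛-cong k.refl (⋀-update i V.≈ᴹ-refl v≈u))))

    ⋀-swap : ∀ {u v : Vector U d} i j → i ≢ j → v i ≈ᴹ u j → v j ≈ᴹ u i →
             (∀ l → l ≢ i → l ≢ j → v l ≈ᴹ u l) → ⋀ u ⊕ ⋀ v Λ.≈ᴹ 𝟘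
    ⋀-swap {u} {v} i j i≢j vi≈uj vj≈ui v≈u = begin
      ⋀ u ⊕ ⋀ v
        ≈⟨ ⊕-cong (⊕-identityˡ _) (Λ.+ᴹ-identityʳ _) ⟨
      (𝟘 ⊕ ⋀ u) ⊕ (⋀ v ⊕ 𝟘)
        ≈⟨ ⊕-cong (⊕-cong (vanish (u i)) (both (V.≈ᴹ-refl) (V.≈ᴹ-refl) (λ _ _ _ → V.≈ᴹ-refl)))
             (⊕-cong (both vi≈uj vj≈ui v≈u) (vanish (u j))) ⟨
      (⋀ (w (u i) (u i)) ⊕ ⋀ (w (u i) (u j))) ⊕ (⋀ (w (u j) (u i)) ⊕ ⋀ (w (u j) (u j)))
        ≈⟨ ⊕-cong (relation (additive _ j _ _)) (relation (additive _ j _ _)) ⟨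
      ⋀ (w (u i) s) ⊕ ⋀ (w (u j) s)
        ≈⟨ ⋀-additive i
             (V.≈ᴹ-trans (w-i s s) (V.≈ᴹ-sym (V.+ᴹ-cong (w-i _ s) (w-i _ s))))
             (λ l l≢i → w-indep l≢i) (λ l l≢i → w-indep l≢i) ⟨
      ⋀ (w s s)
        ≈⟨ vanish s ⟩
      𝟘 ∎
      where
      s = u i +ᴹ u j
      w : U → U → Vector U d
      w x y = u [ i ]≔ x [ j ]≔ y
      w-i : ∀ x y → w x y i ≈ᴹ x
      w-i x y = V.≈ᴹ-trans ([]≔-minimal _ j i≢j) ([]≔-updates u i)
      w-j : ∀ x y → w x y j ≈ᴹ y
      w-j x y = []≔-updates _ j
      w-else : ∀ {x y l} → l ≢ i → l ≢ j → w x y l ≈ᴹ u l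
      w-else l≢i l≢j = V.≈ᴹ-trans ([]≔-minimal _ j l≢j) ([]≔-minimal u i l≢i)
      w-indep : ∀ {x x′ y l} → l ≢ i → w x y l ≈ᴹ w x′ y l
      w-indep {x} {x′} {y} {l} l≢i with l ≟ j
      ... | yes ≡.refl = V.≈ᴹ-trans (w-j x y) (V.≈ᴹ-sym (w-j x′ y))
      ... | no  l≢j    = V.≈ᴹ-trans (w-else l≢i l≢j) (V.≈ᴹ-sym (w-else l≢i l≢j))
      vanish : ∀ x → ⋀ (w x x) Λ.≈ᴹ 𝟘
      vanish x = relation (alternating i≢j (V.≈ᴹ-trans (w-i x x) (V.≈ᴹ-sym (w-j x x))))
      both : ∀ {z x y} → z i ≈ᴹ x → z j ≈ᴹ y → (∀ l → l ≢ i → l ≢ j → z l ≈ᴹ u l) →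
             ⋀ (w x y) Λ.≈ᴹ ⋀ z
      both {z} {x} {y} zi zj z≈u = sym (⋀-update j zj agree)
        where
        agree : ∀ l → l ≢ j → z l ≈ᴹ (u [ i ]≔ x) l
        agree l l≢j with l ≟ i
        ... | yes ≡.refl = V.≈ᴹ-trans zi (V.≈ᴹ-sym ([]≔-updates u i))
        ... | no  l≢i    = V.≈ᴹ-trans (z≈u l l≢i l≢j) (V.≈ᴹ-sym ([]≔-minimal u i l≢i))

    module _ (T : LinearMap V V) where

      diagonal⟨_⟩ : Vector U d → Combination (Vector U d)
      diagonal⟨_⟩ v = ⋀ (map ⟦ T ⟧ v)

      diagonal-resp : ∀ {s t} → ExteriorRelation V d s t →
                      evaluate (ExteriorPower V d) diagonal⟨_⟩ s Λ.≈ᴹ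
                      evaluate (ExteriorPower V d) diagonal⟨_⟩ t
      diagonal-resp (pointwise e) = relation (pointwise (⟦⟧-cong T ∘ e))
      diagonal-resp (additive v i x y) = ⋀-additive i
        (V.≈ᴹ-trans (⟦⟧-cong T (V.≈ᴹ-trans ([]≔-updates v i)
          (V.≈ᴹ-sym (V.+ᴹ-cong ([]≔-updates v i) ([]≔-updates v i))))) (+ᴹ-homo T _ _))
        (λ j j≢i → ⟦⟧-cong T (V.≈ᴹ-trans ([]≔-minimal v i j≢i) (V.≈ᴹ-sym ([]≔-minimal v i j≢i))))
        (λ j j≢i → ⟦⟧-cong T (V.≈ᴹ-trans ([]≔-minimal v i j≢i) (V.≈ᴹ-sym ([]≔-minimal v i j≢i))))
      diagonal-resp (homogeneous v i c x) = ⋀-homogeneous i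
        (V.≈ᴹ-trans (⟦⟧-cong T (V.≈ᴹ-trans ([]≔-updates v i)
          (V.≈ᴹ-sym (V.*ₗ-cong k.refl ([]≔-updates v i))))) (*ₗ-homo T _ _))
        (λ j j≢i → ⟦⟧-cong T (V.≈ᴹ-trans ([]≔-minimal v i j≢i) (V.≈ᴹ-sym ([]≔-minimal v i j≢i))))
      diagonal-resp (alternating i≢j e) = relation (alternating i≢j (⟦⟧-cong T e))

      -- v₁ ∧ … ∧ v_d ↦ T v₁ ∧ … ∧ T v_d
      diagonal : LinearMap (ExteriorPower V d) (ExteriorPower V d)
      diagonal = extend (ExteriorPower V d) diagonal⟨_⟩ diagonal-resp

      slot : Vector U d → Fin d → Vector U d
      slot v i = v [ i ]≔ ⟦ T ⟧ (v i)

      slot-cong : ∀ {v w} i {l} → v i ≈ᴹ w i → v l ≈ᴹ w l → slot v i l ≈ᴹ slot w i l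
      slot-cong {v} {w} i {l} ei el with l ≟ i
      ... | yes ≡.refl = V.≈ᴹ-trans ([]≔-updates v i) (V.≈ᴹ-trans (⟦⟧-cong T ei) (V.≈ᴹ-sym ([]≔-updates w i)))
      ... | no  l≢i    = V.≈ᴹ-trans ([]≔-minimal v i l≢i) (V.≈ᴹ-trans el (V.≈ᴹ-sym ([]≔-minimal w i l≢i)))

      derivation⟨_⟩ : Vector U d → Combination (Vector U d)
      derivation⟨_⟩ v = ∑[ p < d ] ⋀ (v [ p ]≔ ⟦ T ⟧ (v p))

      slot-≢ : ∀ v i {x y p l} → l ≢ i → slot (v [ i ]≔ x) p l ≈ᴹ slot (v [ i ]≔ y) p l
      slot-≢ v i {x} {y} {p} {l} l≢i with l ≟ p
      ... | yes ≡.refl = slot-cong l e e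
        where e = V.≈ᴹ-trans ([]≔-minimal v i l≢i) (V.≈ᴹ-sym ([]≔-minimal v i l≢i))
      ... | no  l≢p    = V.≈ᴹ-trans ([]≔-minimal _ p l≢p) (V.≈ᴹ-trans
        (V.≈ᴹ-trans ([]≔-minimal v i l≢i) (V.≈ᴹ-sym ([]≔-minimal v i l≢i)))
        (V.≈ᴹ-sym ([]≔-minimal _ p l≢p)))

      slot-additive : ∀ v i x y p → ⋀ (slot (v [ i ]≔ (x +ᴹ y)) p) Λ.≈ᴹ
                                    ⋀ (slot (v [ i ]≔ x) p) ⊕ ⋀ (slot (v [ i ]≔ y) p)
      slot-additive v i x y p = ⋀-additive i at-i (λ _ → slot-≢ v i) (λ _ → slot-≢ v i)
        where
        e = V.≈ᴹ-trans ([]≔-updates v i)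
              (V.≈ᴹ-sym (V.+ᴹ-cong ([]≔-updates v i) ([]≔-updates v i)))
        at-i : slot (v [ i ]≔ (x +ᴹ y)) p i ≈ᴹ slot (v [ i ]≔ x) p i +ᴹ slot (v [ i ]≔ y) p i
        at-i with i ≟ p
        ... | yes ≡.refl = V.≈ᴹ-trans ([]≔-updates _ p) (V.≈ᴹ-trans
                (V.≈ᴹ-trans (⟦⟧-cong T e) (+ᴹ-homo T _ _))
                (V.≈ᴹ-sym (V.+ᴹ-cong ([]≔-updates _ p) ([]≔-updates _ p))))
        ... | no  i≢p    = V.≈ᴹ-trans ([]≔-minimal _ p i≢p) (V.≈ᴹ-trans e
                (V.≈ᴹ-sym (V.+ᴹ-cong ([]≔-minimal _ p i≢p) ([]≔-minimal _ p i≢p))))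

      slot-homogeneous : ∀ v i c x p → ⋀ (slot (v [ i ]≔ (c V.*ₗ x)) p) Λ.≈ᴹ
                                       c ⊛ ⋀ (slot (v [ i ]≔ x) p)
      slot-homogeneous v i c x p = ⋀-homogeneous i at-i (λ _ → slot-≢ v i)
        where
        e = V.≈ᴹ-trans ([]≔-updates v i) (V.≈ᴹ-sym (V.*ₗ-cong k.refl ([]≔-updates v i)))
        at-i : slot (v [ i ]≔ (c V.*ₗ x)) p i ≈ᴹ c V.*ₗ slot (v [ i ]≔ x) p i
        at-i with i ≟ p
        ... | yes ≡.refl = V.≈ᴹ-trans ([]≔-updates _ p) (V.≈ᴹ-trans
                (V.≈ᴹ-trans (⟦⟧-cong T e) (*ₗ-homo T _ _))
                (V.≈ᴹ-sym (V.*ₗ-cong k.refl ([]≔-updates _ p))))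
        ... | no  i≢p    = V.≈ᴹ-trans ([]≔-minimal _ p i≢p) (V.≈ᴹ-trans e
                (V.≈ᴹ-sym (V.*ₗ-cong k.refl ([]≔-minimal _ p i≢p))))

      slot-alternating : ∀ {v i j} → i ≢ j → v i ≈ᴹ v j → derivation⟨ v ⟩ Λ.≈ᴹ 𝟘
      slot-alternating {v} {i} {j} i≢j e = Λ.≈ᴹ-trans
        (sum-pair (ExteriorPower V d) (⋀ ∘ slot v) i j i≢j
          (λ p p≢i p≢j → relation (alternating i≢j (V.≈ᴹ-trans ([]≔-minimal v p (p≢i ∘ ≡.sym))
            (V.≈ᴹ-trans e (V.≈ᴹ-sym ([]≔-minimal v p (p≢j ∘ ≡.sym))))))))
        (⋀-swap i j i≢j
          (V.≈ᴹ-trans ([]≔-minimal v j i≢j) (V.≈ᴹ-trans e (V.≈ᴹ-sym ([]≔-minimal v i (i≢j ∘ ≡.sym)))))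
          (V.≈ᴹ-trans ([]≔-updates v j) (V.≈ᴹ-trans (⟦⟧-cong T (V.≈ᴹ-sym e)) (V.≈ᴹ-sym ([]≔-updates v i))))
          (λ l l≢i l≢j → V.≈ᴹ-trans ([]≔-minimal v j l≢j) (V.≈ᴹ-sym ([]≔-minimal v i l≢i))))

      ⊛-sum : ∀ c {n} (f : Vector (Combination (Vector U d)) n) →
              sum (λ p → c ⊛ f p) Λ.≈ᴹ c ⊛ sum f
      ⊛-sum c {zero}  f = sym (⊛-zeroʳ c)
      ⊛-sum c {suc n} f = trans (⊕-cong refl (⊛-sum c (f ∘ suc))) (sym (⊛-distribˡ _ _ _))

      derivation-resp : ∀ {s t} → ExteriorRelation V d s t →
                        evaluate (ExteriorPower V d) derivation⟨_⟩ s Λ.≈ᴹ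
                        evaluate (ExteriorPower V d) derivation⟨_⟩ t
      derivation-resp (pointwise e) =
        sum-cong-≋ (λ p → relation (pointwise (λ l → slot-cong p (e p) (e l))))
      derivation-resp (additive v i x y) =
        trans (sum-cong-≋ (slot-additive v i x y)) (∑-distrib-+ (⋀ ∘ slot (v [ i ]≔ x)) (⋀ ∘ slot (v [ i ]≔ y)))
      derivation-resp (homogeneous v i c x) =
        trans (sum-cong-≋ (slot-homogeneous v i c x)) (⊛-sum c (⋀ ∘ slot (v [ i ]≔ x)))
      derivation-resp (alternating i≢j e) = slot-alternating i≢j e

      -- v₁ ∧ … ∧ v_d ↦ Σₚ v₁ ∧ … ∧ T vₚ ∧ … ∧ v_d
      derivation : LinearMap (ExteriorPower V d) (ExteriorPower V d)
      derivation = extend (ExteriorPower V d) derivation⟨_⟩ derivation-resp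

    derivation-cong : ∀ S T → (∀ x → ⟦ S ⟧ x ≈ᴹ ⟦ T ⟧ x) → ∀ v → derivation⟨ S ⟩ v Λ.≈ᴹ derivation⟨ T ⟩ v
    derivation-cong S T S≈T v = sum-cong-≋ λ p → ⋀-update p
      (V.≈ᴹ-trans ([]≔-updates v p) (S≈T (v p))) (λ j j≢p → []≔-minimal v p j≢p)

    twice : LinearMap V V → LinearMap V V → Vector U d → Fin d → Fin d → Combination (Vector U d)
    twice P Q v p q = ⋀ (slot P (slot Q v p) q)

    derivation² : ∀ P Q v → ⟦ derivation P ⟧ (derivation⟨ Q ⟩ v) Λ.≈ᴹ
                            ∑[ p < d ] ∑[ q < d ] twice P Q v p q
    derivation² P Q v = sum-homo (derivation P) (λ p → ⋀ (slot Q v p))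

    twice-diagonal : ∀ P Q v p → twice P Q v p p Λ.≈ᴹ ⋀ (slot (P ∘ₗ Q) v p)
    twice-diagonal P Q v p = ⋀-update p
      (V.≈ᴹ-trans ([]≔-updates _ p) (⟦⟧-cong P ([]≔-updates v p)))
      (λ j j≢p → V.≈ᴹ-trans ([]≔-minimal _ p j≢p) ([]≔-minimal v p j≢p))

    twice-swap : ∀ P Q v p q → q ≢ p → twice P Q v p q Λ.≈ᴹ twice Q P v q p
    twice-swap P Q v p q q≢p = ⋀-update p
      (V.≈ᴹ-trans ([]≔-minimal _ q (q≢p ∘ ≡.sym)) (V.≈ᴹ-trans ([]≔-updates v p)
        (⟦⟧-cong Q (V.≈ᴹ-sym ([]≔-minimal v q (q≢p ∘ ≡.sym))))))
      agree
      where
      agree : ∀ j → j ≢ p → slot P (slot Q v p) q j ≈ᴹ slot P v q j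
      agree j j≢p = slot-cong P q ([]≔-minimal v p q≢p) ([]≔-minimal v p j≢p)

    derivation-commutator : ∀ S T v →
      derivation⟨ S ∘ₗ T ⟩ v ⊕ ⟦ derivation T ⟧ (derivation⟨ S ⟩ v) Λ.≈ᴹ
      derivation⟨ T ∘ₗ S ⟩ v ⊕ ⟦ derivation S ⟧ (derivation⟨ T ⟩ v)
    derivation-commutator S T v = begin
      derivation⟨ S ∘ₗ T ⟩ v ⊕ ⟦ derivation T ⟧ (derivation⟨ S ⟩ v)
        ≈⟨ ⊕-cong (sum-cong-≋ (twice-diagonal S T v)) (sym (derivation² T S v)) ⟨
      ∑[ p < d ] twice S T v p p ⊕ ∑[ p < d ] ∑[ q < d ] twice T S v p q
        ≈⟨ sum-diagonal (ExteriorPower V d) (twice S T v) (twice T S v) (twice-swap S T v) ⟩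
      ∑[ p < d ] twice T S v p p ⊕ ∑[ p < d ] ∑[ q < d ] twice S T v p q
        ≈⟨ ⊕-cong (sum-cong-≋ (twice-diagonal T S v)) (sym (derivation² S T v)) ⟩
      derivation⟨ T ∘ₗ S ⟩ v ⊕ ⟦ derivation S ⟧ (derivation⟨ T ⟩ v) ∎

  module _ (G : Group a ℓa) where
    private module G = Group G

    record IsRepresentation (M : VectorSpace m ℓm)
             (act : G.Carrier → LeftModule.Carrierᴹ M → LeftModule.Carrierᴹ M) :
             Set (r ⊔ a ⊔ ℓa ⊔ m ⊔ ℓm) where
      open LeftModule M
      field
        act-linear : ∀ g → IsLinear M M (act g)
        act-cong   : ∀ {g h} → g G.≈ h → ∀ v → act g v ≈ᴹ act h v
        act-ε      : ∀ v → act G.ε v ≈ᴹ v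
        act-∙      : ∀ g h v → act (g G.∙ h) v ≈ᴹ act g (act h v)

    record Representation (M : VectorSpace m ℓm) : Set (r ⊔ a ⊔ ℓa ⊔ m ⊔ ℓm) where
      open LeftModule M using (Carrierᴹ)
      field
        act              : G.Carrier → Carrierᴹ → Carrierᴹ
        isRepresentation : IsRepresentation M act
      open IsRepresentation isRepresentation public

      operator : G.Carrier → LinearMap M M
      operator g = record { ⟦_⟧ = act g ; isLinear = act-linear g }

    data SameElement : Rel (Combination G.Carrier) (r ⊔ a ⊔ ℓa) where
      same : ∀ {g h} → g G.≈ h → SameElement ⟨ g ⟩ ⟨ h ⟩

    GroupAlgebra : VectorSpace (r ⊔ a) (r ⊔ ℓr ⊔ a ⊔ ℓa)
    GroupAlgebra = Presented SameElement

    private module k[G] = LeftModule GroupAlgebra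

    leftTranslation : G.Carrier → LinearMap GroupAlgebra GroupAlgebra
    leftTranslation g = extend GroupAlgebra (λ h → ⟨ g G.∙ h ⟩)
      λ { (same h≈h′) → relation (same (G.∙-congˡ h≈h′)) }

    multiplication : LinearMap GroupAlgebra (End GroupAlgebra)
    multiplication = extend (End GroupAlgebra) leftTranslation
      λ { (same {g} {g′} g≈g′) → extensionality GroupAlgebra (leftTranslation g) (leftTranslation g′)
            (λ _ → relation (same (G.∙-congʳ g≈g′))) }

    infixl 7 _⋆_
    _⋆_ : k[G].Carrierᴹ → k[G].Carrierᴹ → k[G].Carrierᴹ
    x ⋆ y = ⟦ ⟦ multiplication ⟧ x ⟧ y

    bracket : k[G].Carrierᴹ → k[G].Carrierᴹ → k[G].Carrierᴹ
    bracket x y = x ⋆ y ⊕ ⊖ (y ⋆ x)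

    conjugate : G.Carrier → k[G].Carrierᴹ → k[G].Carrierᴹ
    conjugate g x = ⟨ g ⟩ ⋆ x ⋆ ⟨ g G.⁻¹ ⟩

    record IsLieSubalgebra (P : Pred k[G].Carrierᴹ p) : Set (r ⊔ ℓr ⊔ a ⊔ ℓa ⊔ p) where
      field
        isSubspace : IsSubspace GroupAlgebra P
        bracket∈   : ∀ {x y} → P x → P y → P (bracket x y)

    module _ {V : VectorSpace m ℓm} (ρ : Representation V) where
      private
        module V = LeftModule V
      open Representation ρ using (operator; act-cong; act-∙)

      -- In degree 0 these give Id and 0, since ⋀ [] is fixed by diagonal and the
      -- sum in derivation is empty.
      𝒢 : ∀ d → LinearMap GroupAlgebra (End (ExteriorPower V d))
      𝒢 d = extend (End (ExteriorPower V d)) (diagonal ∘ operator)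
        λ { (same {g} {h} g≈h) → extensionality (ExteriorPower V d)
              (diagonal (operator g)) (diagonal (operator h))
              (λ v → relation (pointwise (λ i → act-cong g≈h (v i)))) }

      𝒜 : ∀ d → LinearMap GroupAlgebra (End (ExteriorPower V d))
      𝒜 d = extend (End (ExteriorPower V d)) (derivation ∘ operator)
        λ { (same {g} {h} g≈h) → extensionality (ExteriorPower V d)
              (derivation (operator g)) (derivation (operator h))
              (λ v → derivation-cong (operator g) (operator h) (act-cong g≈h) v) }

      module _ (d : ℕ) where
        private
          Λᵈ = ExteriorPower V d
          module Λ = LeftModule Λᵈ

        infix 8 𝒢⟨_⟩_ 𝒜⟨_⟩_
        𝒢⟨_⟩_ 𝒜⟨_⟩_ : k[G].Carrierᴹ → Λ.Carrierᴹ → Λ.Carrierᴹ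
        𝒢⟨ x ⟩ ω = ⟦ ⟦ 𝒢 d ⟧ x ⟧ ω
        𝒜⟨ x ⟩ ω = ⟦ ⟦ 𝒜 d ⟧ x ⟧ ω

        𝒢-⋆ : ∀ x y ω → 𝒢⟨ x ⋆ y ⟩ ω Λ.≈ᴹ 𝒢⟨ x ⟩ (𝒢⟨ y ⟩ ω)
        𝒢-⋆ ⟨ g ⟩ ⟨ h ⟩ = extensionality Λᵈ (diagonal (operator (g G.∙ h)))
          (diagonal (operator g) ∘ₗ diagonal (operator h))
          (λ v → relation (pointwise (λ i → act-∙ g h (v i))))
        𝒢-⋆ ⟨ g ⟩ 𝟘       ω = refl
        𝒢-⋆ ⟨ g ⟩ (s ⊕ t) ω = ⊕-cong (𝒢-⋆ ⟨ g ⟩ s ω) (𝒢-⋆ ⟨ g ⟩ t ω)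
        𝒢-⋆ ⟨ g ⟩ (⊖ s)   ω = ⊖-cong (𝒢-⋆ ⟨ g ⟩ s ω)
        𝒢-⋆ ⟨ g ⟩ (c ⊛ s) ω = ⊛-cong k.refl (𝒢-⋆ ⟨ g ⟩ s ω)
        𝒢-⋆ 𝟘       y ω = refl
        𝒢-⋆ (s ⊕ t) y ω = ⊕-cong (𝒢-⋆ s y ω) (𝒢-⋆ t y ω)
        𝒢-⋆ (⊖ s)   y ω = ⊖-cong (𝒢-⋆ s y ω)
        𝒢-⋆ (c ⊛ s) y ω = ⊛-cong k.refl (𝒢-⋆ s y ω)

        𝒜-commutator : ∀ x y ω → 𝒜⟨ x ⋆ y ⟩ ω ⊕ 𝒜⟨ y ⟩ (𝒜⟨ x ⟩ ω) Λ.≈ᴹ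
                                 𝒜⟨ y ⋆ x ⟩ ω ⊕ 𝒜⟨ x ⟩ (𝒜⟨ y ⟩ ω)
        𝒜-commutator x y ω = extensionality Λᵈ (left y) (right y) (λ g →
          extensionality Λᵈ (right ⟨ g ⟩) (left ⟨ g ⟩) (λ h → generators g h ω) y) x
          where
          _+ₗ_ : ∀ {n ℓn} {N : VectorSpace n ℓn} → LinearMap N Λᵈ → LinearMap N Λᵈ → LinearMap N Λᵈ
          _+ₗ_ {N = N} = LeftModule._+ᴹ_ (Hom N Λᵈ)

          left right : k[G].Carrierᴹ → LinearMap GroupAlgebra Λᵈ
          left  y = (applyₗ ω ∘ₗ 𝒜 d ∘ₗ applyₗ y ∘ₗ multiplication) +ₗ (⟦ 𝒜 d ⟧ y ∘ₗ applyₗ ω ∘ₗ 𝒜 d)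
          right y = (applyₗ ω ∘ₗ 𝒜 d ∘ₗ ⟦ multiplication ⟧ y) +ₗ (applyₗ (𝒜⟨ y ⟩ ω) ∘ₗ 𝒜 d)

          generators : ∀ g h ω → 𝒜⟨ ⟨ g ⟩ ⋆ ⟨ h ⟩ ⟩ ω ⊕ 𝒜⟨ ⟨ h ⟩ ⟩ (𝒜⟨ ⟨ g ⟩ ⟩ ω) Λ.≈ᴹ
                                 𝒜⟨ ⟨ h ⟩ ⋆ ⟨ g ⟩ ⟩ ω ⊕ 𝒜⟨ ⟨ g ⟩ ⟩ (𝒜⟨ ⟨ h ⟩ ⟩ ω)
          generators g h = extensionality Λᵈ
            (derivation (operator (g G.∙ h)) +ₗ (derivation H ∘ₗ derivation K′))
            (derivation (operator (h G.∙ g)) +ₗ (derivation K′ ∘ₗ derivation H))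
            (λ v → trans (⊕-cong (derivation-cong (operator (g G.∙ h)) (K′ ∘ₗ H) (act-∙ g h) v) refl)
                     (trans (derivation-commutator K′ H v)
                       (⊕-cong (sym (derivation-cong (operator (h G.∙ g)) (H ∘ₗ K′) (act-∙ h g) v)) refl)))
            where
            K′ = operator g
            H  = operator h

        product-agree : ∀ x y → (∀ ω → 𝒢⟨ x ⟩ ω Λ.≈ᴹ 𝒜⟨ x ⟩ ω) → (∀ ω → 𝒢⟨ y ⟩ ω Λ.≈ᴹ 𝒜⟨ y ⟩ ω) →
                        ∀ ω → 𝒢⟨ x ⋆ y ⟩ ω Λ.≈ᴹ 𝒜⟨ x ⟩ (𝒜⟨ y ⟩ ω)
        product-agree x y lie-x lie-y ω =
          trans (𝒢-⋆ x y ω) (trans (lie-x (𝒢⟨ y ⟩ ω)) (⟦⟧-cong (⟦ 𝒜 d ⟧ x) (lie-y ω)))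

        bracket-agree : ∀ x y → (∀ ω → 𝒢⟨ x ⟩ ω Λ.≈ᴹ 𝒜⟨ x ⟩ ω) → (∀ ω → 𝒢⟨ y ⟩ ω Λ.≈ᴹ 𝒜⟨ y ⟩ ω) →
                        ∀ ω → 𝒢⟨ bracket x y ⟩ ω Λ.≈ᴹ 𝒜⟨ bracket x y ⟩ ω
        bracket-agree x y lie-x lie-y ω = trans
          (⊕-cong (product-agree x y lie-x lie-y ω) (⊖-cong (product-agree y x lie-y lie-x ω)))
          (sym (transpose (𝒜⟨ x ⋆ y ⟩ ω) (𝒜⟨ y ⟩ (𝒜⟨ x ⟩ ω)) (𝒜⟨ y ⋆ x ⟩ ω) (𝒜⟨ x ⟩ (𝒜⟨ y ⟩ ω))
            (𝒜-commutator x y ω)))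
          where
          open SetoidReasoning Λ.≈ᴹ-setoid
          transpose : ∀ s t u v → s ⊕ t Λ.≈ᴹ u ⊕ v → s ⊕ ⊖ u Λ.≈ᴹ v ⊕ ⊖ t
          transpose s t u v e = begin
            s ⊕ ⊖ u                ≈⟨ ⊕-cong (Λ.+ᴹ-identityʳ s) refl ⟨
            s ⊕ 𝟘 ⊕ ⊖ u            ≈⟨ ⊕-cong (⊕-cong refl (Λ.-ᴹ‿inverseʳ t)) refl ⟨
            s ⊕ (t ⊕ ⊖ t) ⊕ ⊖ u    ≈⟨ ⊕-cong (⊕-assoc s t (⊖ t)) refl ⟨
            s ⊕ t ⊕ ⊖ t ⊕ ⊖ u      ≈⟨ ⊕-cong (⊕-cong e refl) refl ⟩
            u ⊕ v ⊕ ⊖ t ⊕ ⊖ u      ≈⟨ ⊕-cong (⊕-assoc u v (⊖ t)) refl ⟩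
            u ⊕ (v ⊕ ⊖ t) ⊕ ⊖ u    ≈⟨ ⊕-cong (⊕-comm u _) refl ⟩
            v ⊕ ⊖ t ⊕ u ⊕ ⊖ u      ≈⟨ ⊕-assoc _ u (⊖ u) ⟩
            v ⊕ ⊖ t ⊕ (u ⊕ ⊖ u)    ≈⟨ ⊕-cong refl (Λ.-ᴹ‿inverseʳ u) ⟩
            v ⊕ ⊖ t ⊕ 𝟘            ≈⟨ Λ.+ᴹ-identityʳ _ ⟩
            v ⊕ ⊖ t                ∎

      module _ (dimV : FiniteDimensional V) where
        open FiniteDimensional dimV using (dim)

        IsLieElement : Pred k[G].Carrierᴹ (r ⊔ ℓr ⊔ m ⊔ ℓm)
        IsLieElement x = ∀ d → d ≤ dim → LeftModule._≈ᴹ_ (End (ExteriorPower V d)) (⟦ 𝒢 d ⟧ x) (⟦ 𝒜 d ⟧ x)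

        lieElements-isSubspace : IsSubspace GroupAlgebra IsLieElement
        lieElements-isSubspace = record
          { resp = λ x≈y lie d d≤ ω → trans (sym (⟦⟧-cong (𝒢 d) x≈y ω))
                     (trans (lie d d≤ ω) (⟦⟧-cong (𝒜 d) x≈y ω))
          ; 0∈ = λ _ _ _ → refl
          ; +∈ = λ lie lie′ d d≤ ω → ⊕-cong (lie d d≤ ω) (lie′ d d≤ ω)
          ; -∈ = λ lie d d≤ ω → ⊖-cong (lie d d≤ ω)
          ; *∈ = λ _ lie d d≤ ω → ⊛-cong k.refl (lie d d≤ ω)
          }

        lieElements-isLieSubalgebra : IsLieSubalgebra IsLieElement
        lieElements-isLieSubalgebra = record
          { isSubspace = lieElements-isSubspace
          ; bracket∈   = λ {x} {y} lie-x lie-y d d≤ → bracket-agree d x y (lie-x d d≤) (lie-y d d≤)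
          }

        𝓛 : VectorSpace (r ⊔ ℓr ⊔ a ⊔ m ⊔ ℓm) (r ⊔ ℓr ⊔ a ⊔ ℓa)
        𝓛 = subspace GroupAlgebra (IsLieSubalgebra.isSubspace lieElements-isLieSubalgebra)

{-# OPTIONS --safe #-}

-- Writing T = 𝒢⟨g⟩ on Λᵈ V, one has 𝒢⟨g x g⁻¹⟩ = T 𝒢⟨x⟩ T⁻¹ because 𝒢 is
-- multiplicative.  𝒜 is not multiplicative, but 𝒜⟨g x g⁻¹⟩ = T 𝒜⟨x⟩ T⁻¹ still
-- holds: T 𝒜⟨h⟩ T⁻¹ applies g h g⁻¹ to one factor at a time and g g⁻¹ to the
-- others.

module Submission where

open import Level using (Level)
open import Algebra.Apartness.Bundles using (HeytingField)
open import Algebra.Bundles using (CommutativeRing; Group)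
open import Algebra.Module.Bundles using (LeftModule)
import Algebra.Properties.Group as GroupProperties
import Algebra.Properties.CommutativeMonoid.Sum as Sum
open import Data.Nat.Base using (ℕ)
open import Data.Product.Base using (Σ-syntax; _,_; proj₁; proj₂)
open import Data.Vec.Functional using (map)
open import Function.Base using (id)
open import Defs

open LinearMap

private
  variable
    r ℓr a ℓa m ℓm : Level

module _ (k : CommutativeRing r ℓr) {V : VectorSpace k m ℓm} {d : ℕ} where
  private
    module V = LeftModule V
    Λᵈ = ExteriorPower k V d
    module Λ = LeftModule Λᵈ
  open Sum Λ.+ᴹ-commutativeMonoid using (sum-cong-≋)

  -- By linearity `diagonal T` passes through the sum, so the two sides are compared term by term.
  -- In the `p`-th wedge, factor `p` is `T (P (S vₚ))`, while any other factor is `T (S vⱼ)`, which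
  -- the hypothesis returns to `vⱼ`.
  derivation-conjugate : (T P S : LinearMap k V V) → (∀ x → ⟦ T ⟧ (⟦ S ⟧ x) V.≈ᴹ x) →
    ∀ v → derivation⟨_⟩ k (_∘ₗ_ k T (_∘ₗ_ k P S)) v Λ.≈ᴹ
          ⟦ diagonal k T ⟧ (derivation⟨_⟩ k P (map ⟦ S ⟧ v))
  derivation-conjugate T P S TS≈id v = Λ.≈ᴹ-sym (Λ.≈ᴹ-trans
    (sum-homo k (diagonal k T) (λ p → ⟨ slot k {d = d} P (map ⟦ S ⟧ v) p ⟩))
    (sum-cong-≋ λ p → ⋀-update k p
      (⟦⟧-cong T ([]≔-updates k {V = V} _ p))
      (λ j j≢p → V.≈ᴹ-trans (⟦⟧-cong T ([]≔-minimal k {V = V} _ p j≢p)) (TS≈id (v j)))))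

module _ (k : CommutativeRing r ℓr) (G : Group a ℓa) where
  open Group G using (_∙_; _⁻¹; _≈_; ∙-cong; ⁻¹-cong; assoc)
    renaming (ε to e; trans to ≈-trans; sym to ≈-sym; refl to ≈-refl)
  open GroupProperties G using (ε⁻¹≈ε; ⁻¹-anti-homo-∙)
  private
    kG = GroupAlgebra k G
    module kG = LeftModule kG

  -- Its underlying function unfolds to `conjugate k G g`. Having it as a linear map lets
  -- `extensionality` reduce identities about conjugation to single group elements.
  conjugation : Group.Carrier G → LinearMap k kG kG
  conjugation g = _∘ₗ_ k (applyₗ k ⟨ g ⁻¹ ⟩) (_∘ₗ_ k (multiplication k G) (leftTranslation k G g))

  conjugate-cong : ∀ {g h} → g ≈ h → ∀ x → conjugate k G g x kG.≈ᴹ conjugate k G h x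
  conjugate-cong {g} {h} g≈h = extensionality k kG (conjugation g) (conjugation h)
    λ _ → relation (same (∙-cong (∙-cong g≈h ≈-refl) (⁻¹-cong g≈h)))

  conjugate-ε : ∀ x → conjugate k G e x kG.≈ᴹ x
  conjugate-ε = extensionality k kG (conjugation e)
    (record { ⟦_⟧ = id ; isLinear = isLinear⁺ k kG kG id (λ _ _ → refl) (λ _ _ → refl) })
    λ h → relation (same (≈-trans (∙-cong (Group.identityˡ G h) ε⁻¹≈ε) (Group.identityʳ G h)))

  conjugate-∙ : ∀ g h x → conjugate k G (g ∙ h) x kG.≈ᴹ conjugate k G g (conjugate k G h x)
  conjugate-∙ g h = extensionality k kG (conjugation (g ∙ h)) (_∘ₗ_ k (conjugation g) (conjugation h))
    -- Here `x` is a group element: `(gh)x(gh)⁻¹` becomes `(g(hx))(h⁻¹g⁻¹)`, which is then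
    -- rebracketed to `(g((hx)h⁻¹))g⁻¹`.
    λ x → relation (same (≈-trans
      (∙-cong (assoc g h x) (⁻¹-anti-homo-∙ g h))
      (≈-trans (≈-sym (assoc _ _ _)) (∙-cong (assoc _ _ _) ≈-refl))))

  module _ {V : VectorSpace k m ℓm} (ρ : Representation k G V) where
    private module V = LeftModule V
    open Representation ρ using (act; operator; act-cong; act-ε; act-∙)

    -- Supplies the hypothesis of `derivation-conjugate` for `T = ρ(g)` and `S = ρ(g⁻¹)`.
    act-inverse : ∀ g v → act g (act (g ⁻¹) v) V.≈ᴹ v
    act-inverse g v = V.≈ᴹ-trans (V.≈ᴹ-sym (act-∙ g (g ⁻¹) v))
      (V.≈ᴹ-trans (act-cong (Group.inverseʳ G g) v) (act-ε v))

    module _ (d : ℕ) where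
      private
        Λᵈ = ExteriorPower k V d
        module Λ = LeftModule Λᵈ
        𝒢⟨_⟩ 𝒜⟨_⟩ : kG.Carrierᴹ → LinearMap k Λᵈ Λᵈ
        𝒢⟨ x ⟩ = ⟦ 𝒢 k G ρ d ⟧ x
        𝒜⟨ x ⟩ = ⟦ 𝒜 k G ρ d ⟧ x

      𝒢-conjugate : ∀ g x ω → ⟦ 𝒢⟨ conjugate k G g x ⟩ ⟧ ω Λ.≈ᴹ
                              ⟦ 𝒢⟨ ⟨ g ⟩ ⟩ ⟧ (⟦ 𝒢⟨ x ⟩ ⟧ (⟦ 𝒢⟨ ⟨ g ⁻¹ ⟩ ⟩ ⟧ ω))
      𝒢-conjugate g x ω = trans (𝒢-⋆ k G ρ d (_⋆_ k G ⟨ g ⟩ x) ⟨ g ⁻¹ ⟩ ω) (𝒢-⋆ k G ρ d ⟨ g ⟩ x _)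

      -- Both sides are linear in `x` and in `ω`, so it suffices to take `x` a group element and `ω`
      -- a single wedge, where `derivation-conjugate` applies.
      𝒜-conjugate : ∀ g x ω → ⟦ 𝒜⟨ conjugate k G g x ⟩ ⟧ ω Λ.≈ᴹ
                              ⟦ 𝒢⟨ ⟨ g ⟩ ⟩ ⟧ (⟦ 𝒜⟨ x ⟩ ⟧ (⟦ 𝒢⟨ ⟨ g ⁻¹ ⟩ ⟩ ⟧ ω))
      𝒜-conjugate g x ω = extensionality k Λᵈ
        (_∘ₗ_ k (applyₗ k ω) (_∘ₗ_ k (𝒜 k G ρ d) (conjugation g)))
        (_∘ₗ_ k 𝒢⟨ ⟨ g ⟩ ⟩ (_∘ₗ_ k (applyₗ k (⟦ 𝒢⟨ ⟨ g ⁻¹ ⟩ ⟩ ⟧ ω)) (𝒜 k G ρ d)))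
        (λ h → generator h ω) x
        where
        generator : ∀ h ω → ⟦ 𝒜⟨ ⟨ g ∙ h ∙ g ⁻¹ ⟩ ⟩ ⟧ ω Λ.≈ᴹ
                            ⟦ 𝒢⟨ ⟨ g ⟩ ⟩ ⟧ (⟦ 𝒜⟨ ⟨ h ⟩ ⟩ ⟧ (⟦ 𝒢⟨ ⟨ g ⁻¹ ⟩ ⟩ ⟧ ω))
        generator h = extensionality k Λᵈ 𝒜⟨ ⟨ g ∙ h ∙ g ⁻¹ ⟩ ⟩
          (_∘ₗ_ k 𝒢⟨ ⟨ g ⟩ ⟩ (_∘ₗ_ k 𝒜⟨ ⟨ h ⟩ ⟩ 𝒢⟨ ⟨ g ⁻¹ ⟩ ⟩))
          λ v → trans
            -- First factor the operator of `ghg⁻¹` as `ρ(g)ρ(h)ρ(g⁻¹)`.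
            (derivation-cong k (operator (g ∙ h ∙ g ⁻¹))
              (_∘ₗ_ k (operator g) (_∘ₗ_ k (operator h) (operator (g ⁻¹))))
              (λ u → V.≈ᴹ-trans (act-∙ (g ∙ h) (g ⁻¹) u) (act-∙ g h _)) v)
            (derivation-conjugate k (operator g) (operator h) (operator (g ⁻¹)) (act-inverse g) v)

    module _ (dimV : FiniteDimensional k V) where

      conjugate-isLieElement : ∀ g x → IsLieElement k G ρ dimV x →
                               IsLieElement k G ρ dimV (conjugate k G g x)
      conjugate-isLieElement g x lie-x d d≤dim ω = trans (𝒢-conjugate d g x ω) (trans
        -- The Lie condition on `x` is used in the same degree `d`, at the vector `𝒢⟨g⁻¹⟩ ω`.
        (⟦⟧-cong (⟦ 𝒢 k G ρ d ⟧ ⟨ g ⟩) (lie-x d d≤dim _))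
        (sym (𝒜-conjugate d g x ω)))

      -- Equality in `𝓛` is equality of first components, so each law is inherited from conjugation
      -- on the group algebra.
      conjugate-isRepresentation : IsRepresentation k G (𝓛 k G ρ dimV)
        (λ g x → conjugate k G g (proj₁ x) , conjugate-isLieElement g (proj₁ x) (proj₂ x))
      conjugate-isRepresentation = record
        { act-linear = λ g → isLinear⁺ k (𝓛 k G ρ dimV) (𝓛 k G ρ dimV)
            -- `conjugate` computes through `⊕` and `⊛`, hence `refl` for both.
            (⟦⟧-cong (conjugation g)) (λ _ _ → refl) (λ _ _ → refl)
        ; act-cong   = λ g≈h x → conjugate-cong g≈h (proj₁ x)
        ; act-ε      = λ x → conjugate-ε (proj₁ x)
        ; act-∙      = λ g h x → conjugate-∙ g h (proj₁ x)
        }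

corollary8 : ∀ {c ℓ₁ ℓ₂ a ℓa m ℓm : Level}
    (F : HeytingField c ℓ₁ ℓ₂) (G : Group a ℓa)
    (V : VectorSpace (scalars F) m ℓm) (dimV : FiniteDimensional (scalars F) V)
    (ρ : Representation (scalars F) G V) →
    Σ[ closed ∈ (∀ g x → IsLieElement (scalars F) G ρ dimV x →
    IsLieElement (scalars F) G ρ dimV (conjugate (scalars F) G g x)) ]
    IsRepresentation (scalars F) G (𝓛 (scalars F) G ρ dimV)
    (λ g x → conjugate (scalars F) G g (proj₁ x) , closed g (proj₁ x) (proj₂ x))
corollary8 F G V dimV ρ =
  conjugate-isLieElement (scalars F) G ρ dimV , conjugate-isRepresentation (scalars F) G ρ dimV
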